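{- For all possible values of the offsets $\mathrm{off}_x,\mathrm{off}_y$ it holds that $\mathrm{OPT}^{\mathrm{(IP)}}\le \mathrm{OPT}^{\mathrm{(IP2)}}$.
   Context: Setting. Let $\epsilon\in(0,1)$ with $1/\epsilon\in\mathbb{N}$. There are $n$ jobs $J=\{1,\dots,n\}$, each with integral release time $r_j\ge 0$, processing time $p_j\ge1$ and weight $w_j\ge 1$. Standing assumptions: $\min_j r_j=0$, $\max_j r_j\le\sum_j p_j$, $\min_j p_j=1$, $\max_j p_j=P$, and $w_j\le O_\epsilon(n^2P)$. Put $T:=\max_j r_j+\sum_j p_j$. (IP) is the integer program with variables $x_{j,t}\in\{0,1\}$ ($j\in J$, $t\in\{r_j,\dots,T\}$): minimize $\sum_{j\in J}\sum_{t\ge r_j}w_jx_{j,t}$ subject to $\sum_{j: s\le r_j\le t}x_{j,t}p_j\ge\sum_{j:s\le r_j\le t}p_j-(t-s)$ for all integers $0\le s\le t\le T$, and $x_{j,t}\ge x_{j,t+1}$ for all $j\in J$, $t>r_j$ (with $t+1\le T$). $\mathrm{OPT}^{\mathrm{(IP)}}$ is its optimal value. Grid. Let $K:=(2/\epsilon)^{1/\epsilon}$ and let $\ell_{\max}$ be the minimal $k$ with $K^{k-2}\ge T$. The offsets take values $\mathrm{off}_y\in\{(2/\epsilon)^0,\dots,(2/\epsilon)^{1/\epsilon-1}\}$ and $\mathrm{off}_x\in\{ -K^{\ell_{\max}-1}+1,\dots,0\}$. Grid cells are half-open intervals: the unique cell of level $0$ is $[\mathrm{off}_x,\mathrm{off}_x+\mathrm{off}_yK^{\ell_{\max}})$,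 and each cell of level $\ell<\ell_{\max}$ is divided into $K$ equal-length child cells of level $\ell+1$. $\mathcal{C}$ is the set of all cells. For an interval $A=[a,b)$ write $\mathrm{beg}(A)=a$, $\mathrm{end}(A)=b$, $\mathrm{len}(A)=b-a$. Segments. For each job $j$ let $C_{\ell_{\max}}$ be the cell of level $\ell_{\max}$ containing $r_j$, and given $C_k$ let $C_{k-1}$ be the cell of level $k-1$ containing $\mathrm{end}(C_k)$, down to $C_0$. For $k\in\{\ell_{\max}-1,\dots,0\}$ subdivide $[\mathrm{end}(C_{k+1}),\mathrm{end}(C_k))$, and for $k=\ell_{\max}$ subdivide $[r_j,\mathrm{end}(C_{\ell_{\max}}))$, into half-open segments of length $\mathrm{len}(C_{k+2})$ if $k\le\ell_{\max}-2$ and of length $1$ if $k>\ell_{\max}-2$; these segments form $\mathrm{Seg}(j,C_k)$. For all other cells $\mathrm{Seg}(j,C)=\emptyset$. Let $\mathrm{Seg}(j)=\bigcup_{C\in\mathcal{C}}\mathrm{Seg}(j,C)$. The leftmost segment $S$ of $\mathrm{Seg}(j,C)$ has cost $c_{j,S}=w_j(\mathrm{end}(S)-r_j)$; every other $S'\in\mathrm{Seg}(j,C)$ has cost $c_{j,S'}=w_j\,\mathrm{len}(S')$. (IP2) is the integer program with variables $y_{j,S}\in\{0,1\}$ ($j\in J$, $S\in\mathrm{Seg}(j)$): minimize $\sum_{j\in J}\sum_{S\in\mathrm{Seg}(j)}c_{j,S}y_{j,S}$ subject to $\sum_{j:s\le r_j\le t}\ \sum_{S\in\mathrm{Seg}(j):t\in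 S}y_{j,S}p_j\ge\sum_{j:s\le r_j\le t}p_j-(t-s)$ for all integers $0\le s\le t\le T$, and $y_{j,S}\ge y_{j,S'}$ for all $j\in J$, $C\in\mathcal{C}$, $S,S'\in\mathrm{Seg}(j,C)$ with $\mathrm{end}(S)<\mathrm{end}(S')$. $\mathrm{OPT}^{\mathrm{(IP2)}}$ is its optimal value; it depends on $\mathrm{off}_x,\mathrm{off}_y$. -}

module Defs where

open import Data.Bool.Base as Bool using (Bool; if_then_else_)
open import Data.Fin.Base using (Fin; toℕ)
open import Data.Integer.Base as ℤ using (ℤ; +_; 0ℤ; 1ℤ; ∣_∣)
import Data.Integer.Properties as ℤ
open import Data.List.Base
  using (List; []; _∷_; map; foldr; filter; concatMap; mapMaybe; head; applyUpTo; upTo; allFin)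
open import Data.List.Membership.Propositional using (_∈_)
import Data.List.Membership.DecPropositional as DecMembership
open import Data.Maybe.Base as Maybe using (Maybe; just; nothing; _>>=_)
open import Data.Nat.Base using (ℕ; zero; suc; _+_; _*_; _∸_; _^_; _/_; _≤_; NonZero; ≢-nonZero)
open import Data.Nat.ListAction using (sum)
open import Data.Nat.Properties using (_≤?_; m^n≢0; m*n≢0)
open import Data.Product.Base using (_×_; _,_; ∃)
open import Data.Rational.Base as ℚ using (ℚ; 0ℚ; 1ℚ)
import Data.Rational.Properties as ℚ
open import Relation.Binary.Definitions using (DecidableEquality)
open import Relation.Binary.PropositionalEquality using (_≡_; refl; sym; trans; cong)
open import Relation.Nullary using (Dec; yes; no; does; ¬_; _×-dec_)
open import Relation.Nullary.Construct.Add.Supremum using (_⁺; [_]; ⊤⁺)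

IsLeast : (ℕ → Set) → ℕ → Set
IsLeast Q k = Q k × (∀ k′ → Q k′ → k ≤ k′)

IsMin IsMax : ∀ {n} → (Fin n → ℕ) → ℕ → Set
IsMin f v = (∃ λ i → f i ≡ v) × (∀ i → v ≤ f i)
IsMax f v = (∃ λ i → f i ≡ v) × (∀ i → f i ≤ v)

∑ : ∀ {A : Set} → List A → (A → ℤ) → ℤ
∑ xs f = foldr (λ a acc → f a ℤ.+ acc) 0ℤ xs

infixr 6 ∑
syntax ∑ xs (λ a → e) = ∑[ a ∈ xs ] e

bit : Bool → ℤ
bit b = if b then 1ℤ else 0ℤ

record MinimizationProgram : Set₁ where
  field
    Solution : Set
    Feasible : Solution → Set
    cost     : Solution → ℤ

-- The value ⊤⁺ stands for +∞.
IsOptimalValue : MinimizationProgram → ℤ ⁺ → Set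
IsOptimalValue P [ v ] =
  (∃ λ x → Feasible x × cost x ≡ v) × (∀ x → Feasible x → v ℤ.≤ cost x)
  where open MinimizationProgram P
IsOptimalValue P ⊤⁺ = ∀ x → ¬ Feasible x
  where open MinimizationProgram P

record Accuracy : Set where
  field
    ε       : ℚ
    ε⁻¹     : ℕ
    0<ε     : 0ℚ ℚ.< ε
    ε<1     : ε ℚ.< 1ℚ
    ε*ε⁻¹≡1 : ε ℚ.* (+ ε⁻¹ ℚ./ 1) ≡ 1ℚ

  ε⁻¹≢0 : NonZero ε⁻¹
  ε⁻¹≢0 = ≢-nonZero (λ ε⁻¹≡0 → 0≢1
    (trans (sym (ℚ.*-zeroʳ ε)) (trans (cong (λ m → ε ℚ.* (+ m ℚ./ 1)) (sym ε⁻¹≡0)) ε*ε⁻¹≡1)))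
    where
    0≢1 : ¬ (0ℚ ≡ 1ℚ)
    0≢1 ()

  2/ε : ℕ
  2/ε = 2 * ε⁻¹

  2/ε^≢0 : ∀ e → NonZero (2/ε ^ e)
  2/ε^≢0 e = m^n≢0 2/ε e {{m*n≢0 2 ε⁻¹ {{_}} {{ε⁻¹≢0}}}}

  K : ℕ
  K = 2/ε ^ ε⁻¹

-- c is the constant hidden in the bound w j ≤ O_ε(n² P).
record Instance (c : ℕ) : Set where
  field
    n     : ℕ
    r p w : Fin n → ℕ
    rmax  : ℕ
    P     : ℕ
    min-r : IsMin r 0
    max-r : IsMax r rmax
    min-p : IsMin p 1
    max-p : IsMax p P
    1≤w   : ∀ j → 1 ≤ w j
    w≤    : ∀ j → w j ≤ c * (n ^ 2 * P)

  Job : Set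
  Job = Fin n

  jobs : List Job
  jobs = allFin n

  total-p : ℕ
  total-p = sum (map p jobs)

  field
    rmax≤total-p : rmax ≤ total-p

  T : ℕ
  T = rmax + total-p

  releasedIn : ℕ → ℕ → List Job
  releasedIn s t = filter (λ j → (s ≤? r j) ×-dec (r j ≤? t)) jobs

  -- ∑_{j : s ≤ r j ≤ t} p j − (t − s), which may be negative.
  demand : ℕ → ℕ → ℤ
  demand s t = (∑[ j ∈ releasedIn s t ] + p j) ℤ.- (+ t ℤ.- + s)

  times : Job → List ℕ
  times j = filter (r j ≤?_) (upTo (suc T))

  -- Only the values x j t with r j ≤ t ≤ T are variables of the program; the
  -- constraints and the cost do not mention any others.
  record IP-Feasible (x : Job → ℕ → Bool) : Set where
    field
      covering : ∀ s t → s ≤ t → t ≤ T →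
        ∑[ j ∈ releasedIn s t ] bit (x j t) ℤ.* + p j ℤ.≥ demand s t
      monotone : ∀ j t → suc (r j) ≤ t → suc t ≤ T → x j (suc t) Bool.≤ x j t

  IP : MinimizationProgram
  IP = record
    { Solution = Job → ℕ → Bool
    ; Feasible = IP-Feasible
    ; cost     = λ x → ∑[ j ∈ jobs ] ∑[ t ∈ times j ] + w j ℤ.* bit (x j t)
    }

record Interval : Set where
  constructor [_⋯_⟩
  field
    beg end : ℤ

  len : ℤ
  len = end ℤ.- beg

open Interval public

_≟ᴵ_ : DecidableEquality Interval
[ a ⋯ b ⟩ ≟ᴵ [ a′ ⋯ b′ ⟩ with a ℤ.≟ a′ | b ℤ.≟ b′
... | yes refl | yes refl = yes refl
... | no a≢a′  | _        = no (λ { refl → a≢a′ refl })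
... | _        | no b≢b′  = no (λ { refl → b≢b′ refl })

infix 4 _∋_ _∋?_

_∋_ : Interval → ℤ → Set
A ∋ z = beg A ℤ.≤ z × z ℤ.< end A

_∋?_ : ∀ A z → Dec (A ∋ z)
A ∋? z = (beg A ℤ.≤? z) ×-dec (z ℤ.<? end A)

-- N consecutive intervals of length d, from left to right, the first starting at a.
pieces : ℤ → ℕ → ℕ → List Interval
pieces a d N = applyUpTo (λ i → [ a ℤ.+ + (i * d) ⋯ a ℤ.+ + (suc i * d) ⟩) N

subdivide : Interval → (d : ℕ) → .{{NonZero d}} → List Interval
subdivide A d = pieces (beg A) d (∣ len A ∣ / d)

-- The condition K^(k-2) ≥ T, multiplied by K² because k - 2 may be negative.
Isℓmax : Accuracy → ∀ {c} → Instance c → ℕ → Set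
Isℓmax A I = IsLeast (λ k → T * K ^ 2 ≤ K ^ k)
  where
  open Accuracy A
  open Instance I

record Offsets (A : Accuracy) (ℓmax : ℕ) : Set where
  open Accuracy A
  field
    y-exponent : Fin ε⁻¹
    off-x      : ℤ
    off-x-lb   : ℤ.- + (K ^ (ℓmax ∸ 1)) ℤ.+ 1ℤ ℤ.≤ off-x
    off-x-ub   : off-x ℤ.≤ 0ℤ

  off-y : ℕ
  off-y = 2/ε ^ toℕ y-exponent

module Grid (A : Accuracy) {c : ℕ} (I : Instance c) (ℓmax : ℕ) (O : Offsets A ℓmax) where
  open Accuracy A
  open Instance I
  open Offsets O

  -- The length of a cell of level ℓ, for ℓ ≤ ℓmax.
  cellLen : ℕ → ℕ
  cellLen ℓ = off-y * K ^ (ℓmax ∸ ℓ)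

  cells : ℕ → List Interval
  cells zero    = [ off-x ⋯ off-x ℤ.+ + (off-y * K ^ ℓmax) ⟩ ∷ []
  cells (suc ℓ) = concatMap (λ C → pieces (beg C) (cellLen (suc ℓ)) K) (cells ℓ)

  -- A cell together with its level.
  Cell : Set
  Cell = ℕ × Interval

  𝒞 : List Cell
  𝒞 = concatMap (λ ℓ → map (ℓ ,_) (cells ℓ)) (upTo (suc ℓmax))

  cellAt : ℕ → ℤ → Maybe Interval
  cellAt ℓ z = head (filter (_∋? z) (cells ℓ))

  -- anchor j d is the point z such that C_{ℓmax ∸ d} is the cell of level ℓmax ∸ d
  -- containing z: the release time for d = 0, and end(C_{k+1}) for k = ℓmax ∸ d otherwise.
  -- It is also the left endpoint of the range that Seg(j, C_k) subdivides.
  anchor : Job → ℕ → Maybe ℤ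
  anchor j zero    = just (+ r j)
  anchor j (suc d) = Maybe.map end (anchor j d >>= cellAt (ℓmax ∸ d))

  segLen : ℕ → ℕ
  segLen k = if does (k + 2 ≤? ℓmax) then cellLen (k + 2) else 1

  segLen≢0 : ∀ k → NonZero (segLen k)
  segLen≢0 k with does (k + 2 ≤? ℓmax)
  ... | Bool.false = _
  ... | Bool.true  = m*n≢0 off-y (K ^ e) {{2/ε^≢0 (toℕ y-exponent)}} {{m^n≢0 K e {{2/ε^≢0 ε⁻¹}}}}
    where
    e : ℕ
    e = ℓmax ∸ (k + 2)

  -- Meant for cells in 𝒞: such a cell of level ℓ is C_ℓ iff it contains the anchor.
  -- The segments are listed from left to right.
  Seg : Job → Cell → List Interval
  Seg j (ℓ , C) = from (anchor j (ℓmax ∸ ℓ))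
    where
    from : Maybe ℤ → List Interval
    from nothing  = []
    from (just a) =
      if does (C ∋? a) then subdivide [ a ⋯ end C ⟩ (segLen ℓ) {{segLen≢0 ℓ}} else []

  -- The cells in 𝒞 are listed without repetition and the Seg j C are pairwise disjoint,
  -- so this list represents the union ⋃_{C ∈ 𝒞} Seg(j, C).
  SegAll : Job → List Interval
  SegAll j = concatMap (Seg j) 𝒞

  leftmosts : Job → List Interval
  leftmosts j = mapMaybe (λ C → head (Seg j C)) 𝒞

  open DecMembership _≟ᴵ_ using (_∈?_)

  segCost : Job → Interval → ℤ
  segCost j S = + w j ℤ.* (if does (S ∈? leftmosts j) then end S ℤ.- + r j else len S)

  -- Only the values y j S with S ∈ SegAll j are variables of the program; the
  -- constraints and the cost do not mention any others.
  record IP2-Feasible (y : Job → Interval → Bool) : Set where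
    field
      covering : ∀ s t → s ≤ t → t ≤ T →
        ∑[ j ∈ releasedIn s t ] ∑[ S ∈ filter (_∋? + t) (SegAll j) ] bit (y j S) ℤ.* + p j
          ℤ.≥ demand s t
      monotone : ∀ j C → C ∈ 𝒞 → ∀ S S′ → S ∈ Seg j C → S′ ∈ Seg j C →
        end S ℤ.< end S′ → y j S′ Bool.≤ y j S

  IP2 : MinimizationProgram
  IP2 = record
    { Solution = Job → Interval → Bool
    ; Feasible = IP2-Feasible
    ; cost     = λ y → ∑[ j ∈ jobs ] ∑[ S ∈ SegAll j ] segCost j S ℤ.* bit (y j S)
    }

{-# OPTIONS --safe #-}

-- From a solution y of (IP2) take x j t = 1 iff some selected segment of job j ends after t.
-- Within one cell the selected segments form a prefix, whose costs telescope to
-- w j (end S − r j) for its last segment S, so the cost of x does not exceed that of y.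
-- All segments of a job are pairwise disjoint, so at most one of them contains t, and x
-- covers at least as much as y.

module Submission where

open import Defs
open import Data.Bool.Base as Bool using (Bool; true; false; f≤t; b≤b)
import Data.Bool.Properties as Bool
open import Data.Integer.Base as ℤ using (ℤ; +_; 0ℤ; ∣_∣)
import Data.Integer.Properties as ℤ
open import Data.Integer.Tactic.RingSolver using (solve-∀)
open import Data.List.Base using (List; []; _∷_; _++_; concatMap; filter; head; map; applyUpTo; upTo)
import Data.List.Membership.DecPropositional as DecMembership
open import Data.List.Membership.Propositional using (_∈_; find; lose)
open import Data.List.Membership.Propositional.Properties
  using (∈-concatMap⁻; ∈-applyUpTo⁺; ∈-applyUpTo⁻; ∈-upTo⁻; ∈-filter⁻; ∈-map⁻)
open import Data.List.Properties using (filter-++; filter-accept; filter-reject; upTo-∷ʳ)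
open import Data.List.Relation.Unary.All as All using (All; []; _∷_)
import Data.List.Relation.Unary.All.Properties as All
open import Data.List.Relation.Unary.AllPairs as AllPairs using (AllPairs; []; _∷_)
import Data.List.Relation.Unary.AllPairs.Properties as AllPairs
open import Data.List.Relation.Unary.Any as Any using (here; there; any?)
import Data.List.Relation.Unary.Any.Properties as Any
open import Data.Maybe.Base using (just; nothing)
open import Data.Maybe.Properties using (just-injective)
import Data.Maybe.Relation.Unary.Any as MAny
open import Data.Nat.Base as ℕ using (ℕ; zero; suc; z≤n; z<s; s<s; _∸_; NonZero)
open import Data.Nat.DivMod using (m/n*n≤m)
import Data.Nat.Properties as ℕ
open import Data.Product.Base using (_×_; _,_; ∃; proj₂)
open import Data.Sum.Base using (inj₁; inj₂)
open import Function.Base using (_∘_; id)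
open import Relation.Binary.Construct.Add.Supremum.NonStrict ℤ._≤_ using (_≤⁺_; [_]; _≤⊤⁺)
open import Relation.Binary.Core using (Rel)
open import Relation.Binary.PropositionalEquality
  using (_≡_; refl; sym; trans; cong; subst; subst₂)
open import Relation.Nullary using (Dec; yes; no; does; ¬_; contradiction; _×-dec_)
open import Relation.Nullary.Decidable using (dec-true)
open import Relation.Nullary.Construct.Add.Supremum using (_⁺; ⊤⁺; [_])
open import Relation.Unary using (Pred; Decidable)
open import Level using (0ℓ)

private
  variable
    X Y : Set

-- Bits and finite sums of integers.

true⇒≤ : ∀ {b c} → (b ≡ true → c ≡ true) → b Bool.≤ c
true⇒≤ {false} {false} _ = b≤b
true⇒≤ {false} {true}  _ = f≤t
true⇒≤ {true}          h rewrite h refl = b≤b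

≤⇒true : ∀ {b c} → b Bool.≤ c → b ≡ true → c ≡ true
≤⇒true b≤b eq = eq

0≤bit : ∀ b → 0ℤ ℤ.≤ bit b
0≤bit true  = ℤ.+≤+ z≤n
0≤bit false = ℤ.+≤+ z≤n

does⇒ : ∀ {P : Set} (P? : Dec P) → does P? ≡ true → P
does⇒ (yes p) _ = p

*-bit-mono : ∀ k {b c} → (b ≡ true → c ≡ true) → bit b ℤ.* + k ℤ.≤ bit c ℤ.* + k
*-bit-mono k {false} {c} _ = ℤ.*-monoʳ-≤-nonNeg (+ k) (0≤bit c)
*-bit-mono k {true}      h rewrite h refl = ℤ.≤-refl

0≤* : ∀ {i j} → 0ℤ ℤ.≤ i → 0ℤ ℤ.≤ j → 0ℤ ℤ.≤ i ℤ.* j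
0≤* {i} {+ n} 0≤i _ = ℤ.*-monoʳ-≤-nonNeg (+ n) 0≤i

∑-mono : ∀ (xs : List X) {f g : X → ℤ} → (∀ x → f x ℤ.≤ g x) → ∑ xs f ℤ.≤ ∑ xs g
∑-mono []       f≤g = ℤ.≤-refl
∑-mono (x ∷ xs) f≤g = ℤ.+-mono-≤ (f≤g x) (∑-mono xs f≤g)

∑-nonNeg : ∀ {xs : List X} {f} → All (λ x → 0ℤ ℤ.≤ f x) xs → 0ℤ ℤ.≤ ∑ xs f
∑-nonNeg []       = ℤ.≤-refl
∑-nonNeg (p ∷ ps) = ℤ.+-mono-≤ p (∑-nonNeg ps)

∑-++ : ∀ (xs : List X) {ys} f → ∑ (xs ++ ys) f ≡ ∑ xs f ℤ.+ ∑ ys f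
∑-++ []       f = sym (ℤ.+-identityˡ _)
∑-++ (x ∷ xs) f = trans (cong (λ z → f x ℤ.+ z) (∑-++ xs f)) (sym (ℤ.+-assoc (f x) _ _))

∑-concatMap-≥ : ∀ {g : X → List Y} {f xs x} → All (λ y → 0ℤ ℤ.≤ f y) (concatMap g xs) →
                x ∈ xs → ∑ (g x) f ℤ.≤ ∑ (concatMap g xs) f
∑-concatMap-≥ {g = g} {f} {x ∷ xs} 0≤f x∈ with All.++⁻ (g x) 0≤f
∑-concatMap-≥ {g = g} {f} {x ∷ xs} _ (here refl) | _ , 0≤rest =
  subst₂ ℤ._≤_ (ℤ.+-identityʳ _) (sym (∑-++ (g x) f)) (ℤ.+-monoʳ-≤ (∑ (g x) f) (∑-nonNeg 0≤rest))
∑-concatMap-≥ {g = g} {f} {x ∷ xs} _ (there x∈) | 0≤here , 0≤rest =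
  subst₂ ℤ._≤_ (ℤ.+-identityˡ _) (sym (∑-++ (g x) f))
    (ℤ.+-mono-≤ (∑-nonNeg 0≤here) (∑-concatMap-≥ {g = g} 0≤rest x∈))

-- The increments of `h` up to `m` add up to `h m`, and the entries after `m` contribute nonnegative
-- terms only. In the application, `h i` is the full cost of finishing at the end of segment `i` of
-- a cell.
∑-telescope : ∀ (f : ℕ → X) (F : X → ℤ) (h : ℕ → ℤ) → (∀ i → 0ℤ ℤ.≤ F (f i)) →
  ∀ {m N} → h 0 ℤ.≤ F (f 0) → (∀ i → i ℕ.< m → h (suc i) ℤ.- h i ℤ.≤ F (f (suc i))) →
  m ℕ.< N → h m ℤ.≤ ∑ (applyUpTo f N) F
∑-telescope f F h 0≤F {zero} {suc N} base step _ =
  subst (ℤ._≤ _) (ℤ.+-identityʳ _)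
    (ℤ.+-mono-≤ base (∑-nonNeg {f = F} (All.applyUpTo⁺₂ (f ∘ suc) N (0≤F ∘ suc))))
∑-telescope f F h 0≤F {suc m} {suc N} base step (s<s m<N) =
  -- Shifting `f` and measuring `h` from `h 0` leaves a shorter instance, whose base case is the
  -- first increment.
  subst (ℤ._≤ _) (recombine (h 0) (h (suc m)))
    (ℤ.+-mono-≤ base (∑-telescope (f ∘ suc) F (λ i → h (suc i) ℤ.- h 0) (0≤F ∘ suc)
      (step 0 z<s)
      (λ i i<m → subst (ℤ._≤ _) (shift (h (suc (suc i))) (h (suc i)) (h 0))
                   (step (suc i) (s<s i<m)))
      m<N))
  where
  recombine : ∀ u v → u ℤ.+ (v ℤ.- u) ≡ v
  recombine = solve-∀
  shift : ∀ u v z → u ℤ.- v ≡ (u ℤ.- z) ℤ.- (v ℤ.- z)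
  shift = solve-∀

∑-filter-upTo-suc : ∀ {P : Pred ℕ 0ℓ} (P? : Decidable P) F N →
  ∑ (filter P? (upTo (suc N))) F ≡ ∑ (filter P? (upTo N)) F ℤ.+ ∑ (filter P? (N ∷ [])) F
∑-filter-upTo-suc P? F N = trans
  (cong (λ ts → ∑ ts F)
    (trans (cong (filter P?) (sym (upTo-∷ʳ N))) (filter-++ P? (upTo N) (N ∷ []))))
  (∑-++ (filter P? (upTo N)) F)

-- The cost of one job in (IP).

module _ (w r : ℕ) (b : ℕ → Bool) where

  private
    cost : ℕ → ℤ
    cost t = + w ℤ.* bit (b t)

    S : ℕ → ℤ
    S N = ∑ (filter (r ℕ.≤?_) (upTo N)) cost

    S-suc : ∀ N {ts} → filter (r ℕ.≤?_) (N ∷ []) ≡ ts → S (suc N) ≡ S N ℤ.+ ∑ ts cost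
    S-suc N eq = trans (∑-filter-upTo-suc (r ℕ.≤?_) cost N) (cong (λ ts → S N ℤ.+ ∑ ts cost) eq)

    S-reject : ∀ {N} → ¬ r ℕ.≤ N → S (suc N) ≡ S N
    S-reject {N} r≰N = trans (S-suc N (filter-reject (r ℕ.≤?_) r≰N)) (ℤ.+-identityʳ _)

    S-accept : ∀ {N} → r ℕ.≤ N → S (suc N) ≡ S N ℤ.+ cost N
    S-accept {N} r≤N = trans (S-suc N (filter-accept (r ℕ.≤?_) r≤N))
      (cong (λ z → S N ℤ.+ z) (ℤ.+-identityʳ _))

    w*bit≤w : ∀ c → + w ℤ.* bit c ℤ.≤ + w
    w*bit≤w true  = ℤ.≤-reflexive (ℤ.*-identityʳ _)
    w*bit≤w false = subst (ℤ._≤ + w) (sym (ℤ.*-zeroʳ (+ w))) (ℤ.+≤+ z≤n)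

  -- There are `N ∸ r` times from `r` up to but excluding `N`, and each costs at most `w`.
  ∑-times-≤ : ∀ N → S N ℤ.≤ + (w ℕ.* (N ∸ r))
  ∑-times-≤ zero = ℤ.+≤+ z≤n
  ∑-times-≤ (suc N) with r ℕ.≤? N
  ... | no r≰N = subst (ℤ._≤ _) (sym (S-reject r≰N))
    (ℤ.≤-trans (∑-times-≤ N) (ℤ.+≤+ (ℕ.*-monoʳ-≤ w (ℕ.∸-monoˡ-≤ r (ℕ.n≤1+n N)))))
  ... | yes r≤N = subst₂ ℤ._≤_ (sym (S-accept r≤N)) (cong +_ eq)
    (ℤ.+-mono-≤ (∑-times-≤ N) (w*bit≤w (b N)))
    where
    eq : w ℕ.* (N ∸ r) ℕ.+ w ≡ w ℕ.* (suc N ∸ r)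
    eq rewrite ℕ.+-∸-assoc 1 r≤N | ℕ.*-suc w (N ∸ r) = ℕ.+-comm _ w

  -- Times are removed from the top while their bits are 0. At the last set bit `t`, counting every
  -- earlier bit as 1 gives at most `w (t + 1 - r)`, which the hypothesis bounds by `V`.
  ∑-times-≤-last : ∀ {V} → 0ℤ ℤ.≤ V →
    (∀ t → r ℕ.≤ t → b t ≡ true → + (w ℕ.* (suc t ∸ r)) ℤ.≤ V) → ∀ N → S N ℤ.≤ V
  ∑-times-≤-last 0≤V h zero = 0≤V
  ∑-times-≤-last {V} 0≤V h (suc N) with r ℕ.≤? N | b N in bN
  ... | no r≰N  | _ = subst (ℤ._≤ V) (sym (S-reject r≰N)) (∑-times-≤-last 0≤V h N)
  ... | yes r≤N | true  = ℤ.≤-trans (∑-times-≤ (suc N)) (h N r≤N bN)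
  ... | yes r≤N | false = subst (ℤ._≤ V) (sym eq) (∑-times-≤-last 0≤V h N)
    where
    eq : S (suc N) ≡ S N
    eq = trans (S-accept r≤N) (trans
      (cong (λ z → S N ℤ.+ z) (trans (cong (λ c → + w ℤ.* bit c) bN) (ℤ.*-zeroʳ (+ w))))
      (ℤ.+-identityʳ _))

-- Pairwise disjoint intervals.

concatMap-AllPairs : ∀ {R : Rel Y 0ℓ} {f : X → List Y} {xs} → All (AllPairs R ∘ f) xs →
  AllPairs (λ x x′ → ∀ u v → u ∈ f x → v ∈ f x′ → R u v) xs → AllPairs R (concatMap f xs)
concatMap-AllPairs within across = AllPairs.concat⁺ (All.map⁺ within)
  (AllPairs.map⁺ (AllPairs.map (λ h → All.tabulate λ u∈ → All.tabulate λ v∈ → h _ _ u∈ v∈) across))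

AllPairs-mapWith : ∀ {P : Pred X 0ℓ} {Q R : Rel X 0ℓ} {xs} →
  (∀ {x y} → P x → P y → Q x y → R x y) → All P xs → AllPairs Q xs → AllPairs R xs
AllPairs-mapWith h []       []       = []
AllPairs-mapWith h (p ∷ ps) (q ∷ qs) =
  All.zipWith (λ { (p′ , q′) → h p p′ q′ }) (ps , q) ∷ AllPairs-mapWith h ps qs

Disjoint : Interval → Interval → Set
Disjoint A B = ∀ z → A ∋ z → ¬ B ∋ z

-- The field `beg≤end` is what later keeps segment lengths, and thus costs, nonnegative.
record Within (a b : ℤ) (S : Interval) : Set where
  constructor within
  field
    a≤beg   : a ℤ.≤ beg S
    beg≤end : beg S ℤ.≤ end S
    end≤b   : end S ℤ.≤ b

open Within

Within-mono : ∀ {a a′ b b′ S} → a′ ℤ.≤ a → b ℤ.≤ b′ → Within a b S → Within a′ b′ S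
Within-mono a′≤a b≤b′ (within p q s) = within (ℤ.≤-trans a′≤a p) q (ℤ.≤-trans s b≤b′)

Within-∋ : ∀ {a b S z} → Within a b S → S ∋ z → [ a ⋯ b ⟩ ∋ z
Within-∋ (within p _ s) (l , u) = ℤ.≤-trans p l , ℤ.<-≤-trans u s

separated⇒Disjoint : ∀ {A B} → end A ℤ.≤ beg B → Disjoint A B
separated⇒Disjoint e≤b _ (_ , z<e) (b≤z , _) = ℤ.<⇒≱ z<e (ℤ.≤-trans e≤b b≤z)

Disjoint-sym : ∀ {A B} → Disjoint A B → Disjoint B A
Disjoint-sym d z B∋z A∋z = d z A∋z B∋z

head-filter-∋ : ∀ {xs C z} → AllPairs Disjoint xs → C ∈ xs → C ∋ z →
                head (filter (_∋? z) xs) ≡ just C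
head-filter-∋ {z = z} (_ ∷ _) (here refl) C∋z = cong head (filter-accept (_∋? z) C∋z)
head-filter-∋ {z = z} (d ∷ ds) (there C∈) C∋z =
  trans (cong head (filter-reject (_∋? z) (λ x∋z → All.lookup d C∈ z x∋z C∋z)))
        (head-filter-∋ ds C∈ C∋z)

head-∈ : ∀ {xs : List X} {x} → head xs ≡ just x → x ∈ xs
head-∈ {xs = _ ∷ _} refl = here refl

-- Consecutive intervals of equal length.

piece : ℤ → ℕ → ℕ → Interval
piece a d i = [ a ℤ.+ + (i ℕ.* d) ⋯ a ℤ.+ + (suc i ℕ.* d) ⟩

-- The end of a piece is definitionally the beginning of the next one, so this single estimate gives
-- ordered endpoints, containment and separation.
piece-mono : ∀ a d {i k} → i ℕ.≤ k → a ℤ.+ + (i ℕ.* d) ℤ.≤ a ℤ.+ + (k ℕ.* d)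
piece-mono a d i≤k = ℤ.+-monoʳ-≤ a (ℤ.+≤+ (ℕ.*-monoˡ-≤ d i≤k))

piece-within : ∀ a d {i N} → i ℕ.< N → Within a (a ℤ.+ + (N ℕ.* d)) (piece a d i)
piece-within a d {i} i<N = within (ℤ.i≤i+j a _) (piece-mono a d (ℕ.n≤1+n i)) (piece-mono a d i<N)

pieces-within : ∀ a d N {S} → S ∈ pieces a d N → Within a (a ℤ.+ + (N ℕ.* d)) S
pieces-within a d N S∈ with _ , i<N , refl ← ∈-applyUpTo⁻ (piece a d) S∈ = piece-within a d i<N

pieces-disjoint : ∀ a d N → AllPairs Disjoint (pieces a d N)
pieces-disjoint a d N =
  AllPairs.applyUpTo⁺₁ (piece a d) N (λ i<k _ → separated⇒Disjoint (piece-mono a d i<k))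

end-piece-mono-< : ∀ a d .{{_ : NonZero d}} {i k} → i ℕ.< k →
                   end (piece a d i) ℤ.< end (piece a d k)
end-piece-mono-< a d i<k = ℤ.+-monoʳ-< a (ℤ.+<+ (ℕ.*-monoˡ-< d (s<s i<k)))

-- Integer division rounds down, so the pieces cannot run past `e`.
bound-subdivide : ∀ {a e} d .{{_ : NonZero d}} → a ℤ.≤ e →
                  a ℤ.+ + (∣ e ℤ.- a ∣ ℕ./ d ℕ.* d) ℤ.≤ e
bound-subdivide {a} {e} d a≤e = begin
  a ℤ.+ + (∣ e ℤ.- a ∣ ℕ./ d ℕ.* d) ≤⟨ ℤ.+-monoʳ-≤ a (ℤ.+≤+ (m/n*n≤m ∣ e ℤ.- a ∣ d)) ⟩
  a ℤ.+ + ∣ e ℤ.- a ∣               ≡⟨ cong (λ z → a ℤ.+ z) (ℤ.0≤i⇒+∣i∣≡i (ℤ.i≤j⇒0≤j-i a≤e)) ⟩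
  a ℤ.+ (e ℤ.- a)                   ≡⟨ recombine a e ⟩
  e                                 ∎
  where
  open ℤ.≤-Reasoning
  recombine : ∀ u v → u ℤ.+ (v ℤ.- u) ≡ v
  recombine = solve-∀

-- Grid cells.

module GridProperties (A : Accuracy) {c : ℕ} (I : Instance c) (ℓmax : ℕ) (O : Offsets A ℓmax) where
  open Accuracy A using (K; ε⁻¹)
  open Instance I using (Job; jobs; r; p; w; T; times; releasedIn; IP; IP-Feasible)
  open Offsets O
  open Grid A I ℓmax O
  open DecMembership _≟ᴵ_ using (_∈?_)

  -- One factor `K` is split off the power; hence `K` children span exactly the length of their
  -- parent.
  cellLen-suc : ∀ {ℓ} → suc ℓ ℕ.≤ ℓmax → K ℕ.* cellLen (suc ℓ) ≡ cellLen ℓ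
  cellLen-suc {ℓ} ℓ<ℓmax rewrite ℕ.+-∸-assoc 1 ℓ<ℓmax =
    trans (sym (ℕ.*-assoc K off-y _))
      (trans (cong (λ m → m ℕ.* K ℕ.^ (ℓmax ∸ suc ℓ)) (ℕ.*-comm K off-y)) (ℕ.*-assoc off-y K _))

  cells-end : ∀ ℓ {C} → C ∈ cells ℓ → end C ≡ beg C ℤ.+ + cellLen ℓ
  cells-end zero (here refl) = refl
  cells-end (suc ℓ) C∈
    with D , _ , C∈D ← find (∈-concatMap⁻ _ {xs = cells ℓ} C∈)
    with i , _ , refl ← ∈-applyUpTo⁻ (piece (beg D) (cellLen (suc ℓ))) C∈D
    = trans (cong (λ z → beg D ℤ.+ z)
              (trans (cong +_ (ℕ.+-comm (cellLen (suc ℓ)) _)) (ℤ.pos-+ (i ℕ.* cellLen (suc ℓ)) _)))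
        (sym (ℤ.+-assoc (beg D) _ _))

  child-within : ∀ ℓ {C D} → suc ℓ ℕ.≤ ℓmax → D ∈ cells ℓ →
                 C ∈ pieces (beg D) (cellLen (suc ℓ)) K → Within (beg D) (end D) C
  child-within ℓ {C} {D} ℓ<ℓmax D∈ C∈ =
    subst (λ b → Within (beg D) b C)
      (trans (cong (λ m → beg D ℤ.+ + m) (cellLen-suc ℓ<ℓmax)) (sym (cells-end ℓ D∈)))
      (pieces-within (beg D) (cellLen (suc ℓ)) K C∈)

  -- Siblings are consecutive pieces; cells with different parents lie inside parents that are
  -- disjoint by induction.
  cells-disjoint : ∀ ℓ → ℓ ℕ.≤ ℓmax → AllPairs Disjoint (cells ℓ)
  cells-disjoint zero    _      = [] ∷ []
  cells-disjoint (suc ℓ) ℓ<ℓmax = concatMap-AllPairs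
    (All.universal (λ D → pieces-disjoint (beg D) (cellLen (suc ℓ)) K) (cells ℓ))
    (AllPairs-mapWith
      (λ D∈ D′∈ disj _ _ C∈ C′∈ z C∋z C′∋z →
        disj z (Within-∋ (child-within ℓ ℓ<ℓmax D∈ C∈) C∋z)
             (Within-∋ (child-within ℓ ℓ<ℓmax D′∈ C′∈) C′∋z))
      (All.tabulate id) (cells-disjoint ℓ (ℕ.<⇒≤ ℓ<ℓmax)))

  cellAt-∋ : ∀ ℓ {C z} → ℓ ℕ.≤ ℓmax → C ∈ cells ℓ → C ∋ z → cellAt ℓ z ≡ just C
  cellAt-∋ ℓ ℓ≤ = head-filter-∋ (cells-disjoint ℓ ℓ≤)

  -- Anchors and segments of a job.

  anchor-pred : ∀ j d {b} → anchor j (suc d) ≡ just b → ∃ λ a → anchor j d ≡ just a × a ℤ.≤ b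
  anchor-pred j d eq with anchor j d
  ... | just a with cellAt (ℓmax ∸ d) a in at
  anchor-pred j d refl | just a | just C =
    a , refl , ℤ.<⇒≤ (proj₂ (proj₂ (∈-filter⁻ (_∋? a) {xs = cells (ℓmax ∸ d)} (head-∈ at))))

  -- The next anchor is the end of a half-open cell containing the current one, so each step moves
  -- right. The gap `e` is explicit to allow induction on it.
  anchor-mono′ : ∀ j d e {a b} → anchor j d ≡ just a → anchor j (e ℕ.+ d) ≡ just b → a ℤ.≤ b
  anchor-mono′ j d zero    eqa eqb = ℤ.≤-reflexive (just-injective (trans (sym eqa) eqb))
  anchor-mono′ j d (suc e) eqa eqb with _ , eqc , c≤b ← anchor-pred j (e ℕ.+ d) eqb =
    ℤ.≤-trans (anchor-mono′ j d e eqa eqc) c≤b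

  anchor-mono : ∀ j {d d′ a b} → d ℕ.≤ d′ → anchor j d ≡ just a → anchor j d′ ≡ just b → a ℤ.≤ b
  anchor-mono j {d} {d′} d≤d′ eqa eqb =
    anchor-mono′ j d (d′ ∸ d) eqa (trans (cong (anchor j) (ℕ.m∸n+n≡m d≤d′)) eqb)

  r≤anchor : ∀ j d {a} → anchor j d ≡ just a → + r j ℤ.≤ a
  r≤anchor j d = anchor-mono j {d = 0} {d} z≤n refl

  -- Case analysis for the nested `Maybe` and `if` in `Seg`. The number of pieces stays abstract and
  -- is controlled only through the end of the cell.
  data SegView (j : Job) (ℓ : ℕ) (C : Interval) : List Interval → Set where
    none : SegView j ℓ C []
    some : ∀ a N → anchor j (ℓmax ∸ ℓ) ≡ just a → C ∋ a →
           a ℤ.+ + (N ℕ.* segLen ℓ) ℤ.≤ end C → SegView j ℓ C (pieces a (segLen ℓ) N)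

  segView : ∀ j ℓ C → SegView j ℓ C (Seg j (ℓ , C))
  segView j ℓ C with anchor j (ℓmax ∸ ℓ) in eq
  ... | nothing = none
  ... | just a with does (C ∋? a) in C∋?a≡
  ...   | false = none
  ...   | true  = some a _ eq C∋a (bound-subdivide (segLen ℓ) {{segLen≢0 ℓ}} (ℤ.<⇒≤ (proj₂ C∋a)))
    where
    C∋a = does⇒ (C ∋? a) C∋?a≡

  Seg-disjoint : ∀ j C → AllPairs Disjoint (Seg j C)
  Seg-disjoint j (ℓ , C) with Seg j (ℓ , C) | segView j ℓ C
  ... | _ | none           = []
  ... | _ | some a N _ _ _ = pieces-disjoint a (segLen ℓ) N

  Seg-within : ∀ j ℓ C {S} → S ∈ Seg j (ℓ , C) →
    ∃ λ a → anchor j (ℓmax ∸ ℓ) ≡ just a × C ∋ a × Within a (end C) S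
  Seg-within j ℓ C S∈ with Seg j (ℓ , C) | segView j ℓ C
  ... | _ | some a N eq C∋a bd =
    a , eq , C∋a , Within-mono ℤ.≤-refl bd (pieces-within a (segLen ℓ) N S∈)

  Apart : Job → Cell → Cell → Set
  Apart j C C′ = ∀ S S′ → S ∈ Seg j C → S′ ∈ Seg j C′ → Disjoint S S′

  -- Both cells would have to contain the same anchor, so disjoint cells cannot both carry segments.
  Seg-apart-sameLevel : ∀ j ℓ {C C′} → Disjoint C C′ → Apart j (ℓ , C) (ℓ , C′)
  Seg-apart-sameLevel j ℓ {C} {C′} disj _ _ S∈ S′∈
    with _ , eq , C∋a , _ ← Seg-within j ℓ C S∈ | _ , eq′ , C′∋a , _ ← Seg-within j ℓ C′ S′∈
    with refl ← just-injective (trans (sym eq) eq′)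
    = contradiction C′∋a (disj _ C∋a)

  -- Cells of one level are disjoint, so `cellAt` can return no cell other than `C`.
  anchor-suc : ∀ j {ℓ C a} → ℓ ℕ.≤ ℓmax → C ∈ cells ℓ → anchor j (ℓmax ∸ ℓ) ≡ just a → C ∋ a →
               anchor j (suc (ℓmax ∸ ℓ)) ≡ just (end C)
  anchor-suc j {ℓ} ℓ≤ C∈ eq C∋a
    rewrite eq | ℕ.m∸[m∸n]≡n ℓ≤ | cellAt-∋ ℓ ℓ≤ C∈ C∋a = refl

  -- The segments of the finer cell `C′` stop by `end C′`, which is the next anchor. Anchors only
  -- move right towards coarser levels, and the segments of `C` start at a later or equal anchor.
  Seg-apart-levels : ∀ j {ℓ ℓ′ C C′} → ℓ ℕ.< ℓ′ → ℓ′ ℕ.≤ ℓmax → C′ ∈ cells ℓ′ →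
                     Apart j (ℓ , C) (ℓ′ , C′)
  Seg-apart-levels j {ℓ} {ℓ′} {C} {C′} ℓ<ℓ′ ℓ′≤ C′∈ _ _ S∈ S′∈
    with _ , eq , _ , W ← Seg-within j ℓ C S∈ | _ , eq′ , C′∋a , W′ ← Seg-within j ℓ′ C′ S′∈
    = Disjoint-sym (separated⇒Disjoint (ℤ.≤-trans (end≤b W′) (ℤ.≤-trans
        (anchor-mono j (ℕ.∸-monoʳ-< ℓ<ℓ′ ℓ′≤) (anchor-suc j ℓ′≤ C′∈ eq′ C′∋a) eq)
        (a≤beg W))))

  level : ℕ → List Cell
  level ℓ = map (ℓ ,_) (cells ℓ)

  level-apart : ∀ j {ℓ} → ℓ ℕ.≤ ℓmax → AllPairs (Apart j) (level ℓ)
  level-apart j {ℓ} ℓ≤ = AllPairs.map⁺ apart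
    where
    apart : AllPairs (λ C C′ → Apart j (ℓ , C) (ℓ , C′)) (cells ℓ)
    apart = AllPairs.map (Seg-apart-sameLevel j ℓ) (cells-disjoint ℓ ℓ≤)

  levels-apart : ∀ j {ℓ ℓ′} → ℓ ℕ.< ℓ′ → ℓ′ ℕ.< suc ℓmax →
                 ∀ C C′ → C ∈ level ℓ → C′ ∈ level ℓ′ → Apart j C C′
  levels-apart j ℓ<ℓ′ ℓ′< _ _ C∈ C′∈
    with _ , _ , refl ← ∈-map⁻ _ C∈ | _ , C′∈cells , refl ← ∈-map⁻ _ C′∈
    = Seg-apart-levels j ℓ<ℓ′ (ℕ.≤-pred ℓ′<) C′∈cells

  -- Three layers: pieces inside one cell, cells of one level, and cells of different levels.
  SegAll-disjoint : ∀ j → AllPairs Disjoint (SegAll j)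
  SegAll-disjoint j = concatMap-AllPairs (All.universal (Seg-disjoint j) 𝒞)
    (concatMap-AllPairs (All.tabulate (level-apart j ∘ ℕ.≤-pred ∘ ∈-upTo⁻))
      (AllPairs.applyUpTo⁺₁ id (suc ℓmax) (levels-apart j)))

  SegAll⁻ : ∀ j {S} → S ∈ SegAll j → ∃ λ C → C ∈ 𝒞 × S ∈ Seg j C
  SegAll⁻ j S∈ = find (∈-concatMap⁻ (Seg j) {xs = 𝒞} S∈)

  -- Segment costs.

  Proper : Job → Interval → Set
  Proper j S = + r j ℤ.≤ beg S × beg S ℤ.≤ end S

  SegAll-proper : ∀ j {S} → S ∈ SegAll j → Proper j S
  SegAll-proper j S∈ with (ℓ , C) , _ , S∈C ← SegAll⁻ j S∈
    with _ , eq , _ , W ← Seg-within j ℓ C S∈C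
    = ℤ.≤-trans (r≤anchor j (ℓmax ∸ ℓ) eq) (a≤beg W) , beg≤end W

  -- A leftmost segment is charged from `r j`, which is no later than its beginning. This bounds
  -- every segment without deciding whether it is leftmost.
  segCost-≥-len : ∀ j S → Proper j S → + w j ℤ.* len S ℤ.≤ segCost j S
  segCost-≥-len j S (r≤beg , _) with does (S ∈? leftmosts j)
  ... | true  = ℤ.*-monoˡ-≤-nonNeg (+ w j) (ℤ.+-monoʳ-≤ (end S) (ℤ.neg-mono-≤ r≤beg))
  ... | false = ℤ.≤-refl

  segCost-leftmost : ∀ j S → S ∈ leftmosts j → segCost j S ≡ + w j ℤ.* (end S ℤ.- + r j)
  segCost-leftmost j S S∈ rewrite dec-true (S ∈? leftmosts j) S∈ = refl

  segCost-nonNeg : ∀ j S → Proper j S → 0ℤ ℤ.≤ segCost j S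
  segCost-nonNeg j S pr =
    ℤ.≤-trans (0≤* {+ w j} (ℤ.+≤+ z≤n) (ℤ.i≤j⇒0≤j-i (proj₂ pr))) (segCost-≥-len j S pr)

  head∈leftmosts : ∀ j {C S} → C ∈ 𝒞 → head (Seg j C) ≡ just S → S ∈ leftmosts j
  head∈leftmosts j {C} {S} C∈ eq = Any.mapMaybe⁺ (λ C′ → head (Seg j C′)) 𝒞
    (Any.map⁺ (Any.map (λ { refl → subst (MAny.Any (S ≡_)) (sym eq) (MAny.just refl) }) C∈))

  -- Recovers the index `m` of a segment, so that its predecessors in the cell can be addressed.
  Seg-piece : ∀ j ℓ C {S} → S ∈ Seg j (ℓ , C) → ∃ λ a → ∃ λ N → ∃ λ m → + r j ℤ.≤ a × m ℕ.< N ×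
    S ≡ piece a (segLen ℓ) m × Seg j (ℓ , C) ≡ pieces a (segLen ℓ) N
  Seg-piece j ℓ C S∈ with Seg j (ℓ , C) | segView j ℓ C
  ... | _ | some a N eq _ _ with m , m<N , S≡ ← ∈-applyUpTo⁻ (piece a (segLen ℓ)) S∈ =
    a , N , m , r≤anchor j (ℓmax ∸ ℓ) eq , m<N , S≡ , refl

  -- Rounding a solution of (IP2) to one of (IP).

  module Rounding (y : Job → Interval → Bool) (feas : IP2-Feasible y) where
    open IP2-Feasible feas

    -- `S` has to end after `t` but need not contain it: a witness for `suc t` is then one for `t`,
    -- as monotonicity in (IP) demands.
    EndsAfter : Job → ℕ → Interval → Set
    EndsAfter j t S = y j S ≡ true × + t ℤ.< end S

    endsAfter? : ∀ j t → Dec (Any.Any (EndsAfter j t) (SegAll j))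
    endsAfter? j t = any? (λ S → (y j S Bool.≟ true) ×-dec (+ t ℤ.<? end S)) (SegAll j)

    x : Job → ℕ → Bool
    x j t = does (endsAfter? j t)

    x-true : ∀ {j t S} → S ∈ SegAll j → y j S ≡ true → + t ℤ.< end S → x j t ≡ true
    x-true {j} {t} S∈ yS t<end = dec-true (endsAfter? j t) (lose S∈ (yS , t<end))

    y-cost : Job → Interval → ℤ
    y-cost j S = segCost j S ℤ.* bit (y j S)

    y-cost-nonNeg : ∀ j S → Proper j S → 0ℤ ℤ.≤ y-cost j S
    y-cost-nonNeg j S pr = 0≤* (segCost-nonNeg j S pr) (0≤bit (y j S))

    y-cost-selected : ∀ j S → y j S ≡ true → y-cost j S ≡ segCost j S
    y-cost-selected j S yS rewrite yS = ℤ.*-identityʳ _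

    y-cost-all : ∀ j → All (λ S → 0ℤ ℤ.≤ y-cost j S) (SegAll j)
    y-cost-all j = All.tabulate (λ {S} S∈ → y-cost-nonNeg j S (SegAll-proper j S∈))

    -- Monotonicity in (IP2) selects all predecessors of `S` in its cell, and their costs telescope
    -- from `r j` to `end S`. The remaining segments of the job cost at least 0.
    selected-cost : ∀ j {S} → S ∈ SegAll j → y j S ≡ true →
                    + w j ℤ.* (end S ℤ.- + r j) ℤ.≤ ∑ (SegAll j) (y-cost j)
    selected-cost j {S} S∈ yS with (ℓ , C) , C∈ , S∈C ← SegAll⁻ j S∈
      with a , N , m , r≤a , m<N , refl , Seg≡ ← Seg-piece j ℓ C S∈C =
      ℤ.≤-trans
        (subst (λ L → _ ℤ.≤ ∑ L (y-cost j)) (sym Seg≡)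
          (∑-telescope P (y-cost j) h (λ i → y-cost-nonNeg j (P i) (proper i)) base step m<N))
        (∑-concatMap-≥ {g = Seg j} (y-cost-all j) C∈)
      where
      d = segLen ℓ

      P : ℕ → Interval
      P = piece a d

      h : ℕ → ℤ
      h i = + w j ℤ.* (end (P i) ℤ.- + r j)

      proper : ∀ i → Proper j (P i)
      proper i = ℤ.≤-trans r≤a (ℤ.i≤i+j a _) , piece-mono a d (ℕ.n≤1+n i)

      P∈ : ∀ {i} → i ℕ.< N → P i ∈ Seg j (ℓ , C)
      P∈ {i} i<N = subst (P i ∈_) (sym Seg≡) (∈-applyUpTo⁺ P i<N)

      -- The constraint compares strictly ordered ends only, so `i ≡ m` is split off.
      selected : ∀ {i} → i ℕ.≤ m → y j (P i) ≡ true
      selected {i} i≤m with ℕ.m≤n⇒m<n∨m≡n i≤m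
      ... | inj₂ refl = yS
      ... | inj₁ i<m  = ≤⇒true (monotone j (ℓ , C) C∈ (P i) (P m) (P∈ (ℕ.<-trans i<m m<N)) (P∈ m<N)
        (end-piece-mono-< a d {{segLen≢0 ℓ}} i<m)) yS

      head≡ : ∀ {M} → 0 ℕ.< M → head (pieces a d M) ≡ just (P 0)
      head≡ {suc _} _ = refl

      0<N : 0 ℕ.< N
      0<N = ℕ.≤-<-trans z≤n m<N

      -- The first piece heads the list of its cell, so it is charged from the release time.
      base : h 0 ℤ.≤ y-cost j (P 0)
      base = ℤ.≤-reflexive (sym (trans (y-cost-selected j (P 0) (selected z≤n))
        (segCost-leftmost j (P 0) (head∈leftmosts j C∈ (trans (cong head Seg≡) (head≡ 0<N))))))

      difference : ∀ w e b r → w ℤ.* (e ℤ.- b) ≡ w ℤ.* (e ℤ.- r) ℤ.- w ℤ.* (b ℤ.- r)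
      difference = solve-∀

      -- Piece `suc i` begins where piece `i` ends, so the increment of `h` is its length times
      -- `w j`.
      step : ∀ i → i ℕ.< m → h (suc i) ℤ.- h i ℤ.≤ y-cost j (P (suc i))
      step i i<m = subst₂ ℤ._≤_ (difference (+ w j) (end (P (suc i))) (end (P i)) (+ r j))
        (sym (y-cost-selected j (P (suc i)) (selected i<m)))
        (segCost-≥-len j (P (suc i)) (proper (suc i)))

    x-cost : ∀ j → ∑[ t ∈ times j ] + w j ℤ.* bit (x j t) ℤ.≤ ∑ (SegAll j) (y-cost j)
    -- The bound `suc T` is exclusive: `times j` includes `T` itself.
    x-cost j = ∑-times-≤-last (w j) (r j) (x j) (∑-nonNeg (y-cost-all j)) bound (suc T)
      where
      bound : ∀ t → r j ℕ.≤ t → x j t ≡ true →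
              + (w j ℕ.* (suc t ∸ r j)) ℤ.≤ ∑ (SegAll j) (y-cost j)
      -- The ends are integers, so `t < end S` gives `t + 1 ≤ end S`, absorbing the extra unit of
      -- the time slot `t`.
      bound t r≤t xt with S , S∈ , yS , t<end ← find (does⇒ (endsAfter? j t) xt) = begin
        + (w j ℕ.* (suc t ∸ r j))     ≡⟨ ℤ.pos-* (w j) _ ⟩
        + w j ℤ.* + (suc t ∸ r j)     ≡⟨ cong (λ z → + w j ℤ.* z) (ℤ.⊖-≥ (ℕ.m≤n⇒m≤1+n r≤t)) ⟨
        + w j ℤ.* (suc t ℤ.⊖ r j)     ≡⟨ cong (λ z → + w j ℤ.* z) (ℤ.m-n≡m⊖n (suc t) (r j)) ⟨
        + w j ℤ.* (+ suc t ℤ.- + r j) ≤⟨ ℤ.*-monoˡ-≤-nonNeg (+ w j)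
                                          (ℤ.+-monoˡ-≤ (ℤ.- + r j) (ℤ.i<j⇒suc[i]≤j t<end)) ⟩
        + w j ℤ.* (end S ℤ.- + r j)   ≤⟨ selected-cost j S∈ yS ⟩
        ∑ (SegAll j) (y-cost j)       ∎
        where open ℤ.≤-Reasoning

    -- Disjointness leaves at most one segment containing `t`; if it is selected, it ends after `t`
    -- and sets `x j t`.
    x-covers : ∀ j t →
      ∑[ S ∈ filter (_∋? + t) (SegAll j) ] bit (y j S) ℤ.* + p j ℤ.≤ bit (x j t) ℤ.* + p j
    x-covers j t with filter (_∋? + t) (SegAll j)
                    | AllPairs.filter⁺ (_∋? + t) (SegAll-disjoint j)
                    | All.tabulate (∈-filter⁻ (_∋? + t) {xs = SegAll j})
    ... | []         | _             | _ = 0≤* (0≤bit (x j t)) (ℤ.+≤+ z≤n)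
    ... | S ∷ []     | _             | (S∈ , S∋t) ∷ _ =
      subst (ℤ._≤ _) (sym (ℤ.+-identityʳ _))
        (*-bit-mono (p j) (λ yS → x-true S∈ yS (proj₂ S∋t)))
    ... | S ∷ S′ ∷ _ | (d ∷ _) ∷ _   | (_ , S∋t) ∷ (_ , S′∋t) ∷ _ = contradiction S′∋t (d (+ t) S∋t)

    x-feasible : IP-Feasible x
    x-feasible = record
      { covering = λ s t s≤t t≤T →
          ℤ.≤-trans (covering s t s≤t t≤T) (∑-mono (releasedIn s t) (λ j → x-covers j t))
      ; monotone = λ j t _ _ → true⇒≤ λ xt →
          let S , S∈ , yS , t<end = find (does⇒ (endsAfter? j (suc t)) xt)
          in x-true S∈ yS (ℤ.<-trans (ℤ.+<+ (ℕ.n<1+n t)) t<end)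
      }

    x-total-cost : MinimizationProgram.cost IP x ℤ.≤ MinimizationProgram.cost IP2 y
    x-total-cost = ∑-mono jobs x-cost

lemma4 : (A : Accuracy) (c : ℕ) (I : Instance c) (ℓmax : ℕ) → Isℓmax A I ℓmax →
    (O : Offsets A ℓmax) (OPT-IP OPT-IP2 : ℤ ⁺) →
    IsOptimalValue (Instance.IP I) OPT-IP →
    IsOptimalValue (Grid.IP2 A I ℓmax O) OPT-IP2 →
    OPT-IP ≤⁺ OPT-IP2
-- An infeasible (IP2) has value +∞.
lemma4 A c I ℓmax _ O v      ⊤⁺     _ _ = v ≤⊤⁺
-- Impossible: rounding a feasible `y` yields a feasible solution of (IP).
lemma4 A c I ℓmax _ O ⊤⁺     [ _ ] infeasible ((y , feas , _) , _) =
  contradiction x-feasible (infeasible x)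
  where open GridProperties.Rounding A I ℓmax O y feas
lemma4 A c I ℓmax _ O [ _ ] [ _ ] (_ , least) ((y , feas , refl) , _) =
  [ ℤ.≤-trans (least x x-feasible) x-total-cost ]
  where open GridProperties.Rounding A I ℓmax O y feas
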